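{- Let $S$ be the unique formal power series in the variables $t_1,t_2,\dots$ satisfying $S=1+\sum_{n=1}^\infty t_nS^n$, let $S_1=\sum_{n=1}^\infty t_n$, and define $G=(S-1)/S_1$ and $H=G/S$ in the field of fractions of the ring of formal power series in $t_1,t_2,\dots$. Then $$S=\biggl(1-\sum_{n=1}^{\infty} t_nS^{n-1}\biggr)^{ -1}=\frac{1}{1-HS_1},$$ $$G=\biggl(1-\sum_{n=1}^\infty t_n\,(1+S+S^2+\cdots+S^{n-1})\biggr)^{ -1},$$ and $$H=\biggl(1-\sum_{n=2}^\infty t_n\,(S+S^2+\cdots+S^{n-1})\biggr)^{ -1}.$$
   Context: Formal power series are in infinitely many commuting variables $t_1,t_2,\dots$ (coefficients in the integers or the rationals); a formal power series is an arbitrary, possibly infinite, formal linear combination of monomials in the $t_i$ (each monomial involving finitely many variables), so that for instance $\sum_{n\ge1}t_n$ is a formal power series. This ring is an integral domain, so quotients by nonzero power series make sense in its field of fractions, where $G$ and $H$ are defined a priori. Infinite sums are understood coefficientwise. The equation $S=1+\sum_{n\ge 1}t_nS^n$ has a unique formal power series solution $S$. -}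

module Defs where

open import Algebra.Bundles using (CommutativeRing)
import Algebra.Properties.Semiring.Sum
import Algebra.Definitions as AlgebraDefinitions
open import Data.Fin.Base using (toℕ)
open import Data.Integer.Base as ℤ using (ℤ; 0ℤ; 1ℤ)
import Data.Integer.Properties as ℤ
open import Data.List.Base using (List; []; _∷_; _∷ʳ_; length)
open import Data.List.Properties using (length-++)
open import Data.Nat.Base as ℕ using (ℕ; zero; suc; _∸_; _≤_; z≤n; s≤s)
import Data.Nat.Properties as ℕ
open import Data.Product.Base using (Σ-syntax; ∃-syntax; _×_; _,_)
open import Data.Sum.Base using ([_,_]′)
open import Level using (0ℓ; _⊔_)
open import Relation.Binary.PropositionalEquality
  using (_≡_; _≢_; refl; sym; trans; cong; cong₂; subst; module ≡-Reasoning)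
open import Relation.Binary.Structures using (IsEquivalence)
open import Relation.Nullary using (¬_)
open import Relation.Nullary.Decidable using (decidable-stable)

module ℤ-Sum where
  open import Algebra.Properties.Semiring.Sum ℤ.+-*-semiring public

open ℤ-Sum using (sum-syntax; sum⁺-syntax)

private
  +-congˡ : ∀ a {b c} → b ≡ c → a ℤ.+ b ≡ a ℤ.+ c
  +-congˡ a refl = refl

  swap-middle : ∀ a b c d → (a ℤ.+ b) ℤ.+ (c ℤ.+ d) ≡ (a ℤ.+ c) ℤ.+ (b ℤ.+ d)
  swap-middle = ℤ-interchange
    where
    open import Algebra.Properties.CommutativeSemigroup ℤ.+-commutativeSemigroup
      using () renaming (interchange to ℤ-interchange)

------------------------------------------------------------------------

-- The sum of F i j over all i + j = e.
∑ᵢ₊ⱼ : (ℕ → ℕ → ℤ) → ℕ → ℤ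
∑ᵢ₊ⱼ F e = ∑[ i ≤ e ] F (toℕ i) (e ∸ toℕ i)

∑ᵢ₊ⱼ-cong : ∀ {F G} → (∀ i j → F i j ≡ G i j) → ∀ e → ∑ᵢ₊ⱼ F e ≡ ∑ᵢ₊ⱼ G e
∑ᵢ₊ⱼ-cong F≡G zero    = cong (ℤ._+ 0ℤ) (F≡G 0 0)
∑ᵢ₊ⱼ-cong F≡G (suc e) = cong₂ ℤ._+_ (F≡G 0 (suc e)) (∑ᵢ₊ⱼ-cong (λ i → F≡G (suc i)) e)

∑ᵢ₊ⱼ-0 : ∀ {F} → (∀ i j → F i j ≡ 0ℤ) → ∀ e → ∑ᵢ₊ⱼ F e ≡ 0ℤ
∑ᵢ₊ⱼ-0 F≡0 zero    = cong (ℤ._+ 0ℤ) (F≡0 0 0)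
∑ᵢ₊ⱼ-0 F≡0 (suc e) = cong₂ ℤ._+_ (F≡0 0 (suc e)) (∑ᵢ₊ⱼ-0 (λ i → F≡0 (suc i)) e)

∑ᵢ₊ⱼ-+ : ∀ F G e → ∑ᵢ₊ⱼ (λ i j → F i j ℤ.+ G i j) e ≡ ∑ᵢ₊ⱼ F e ℤ.+ ∑ᵢ₊ⱼ G e
∑ᵢ₊ⱼ-+ F G zero    = swap-middle (F 0 0) (G 0 0) 0ℤ 0ℤ
∑ᵢ₊ⱼ-+ F G (suc e) = trans
  (+-congˡ (F 0 (suc e) ℤ.+ G 0 (suc e)) (∑ᵢ₊ⱼ-+ (λ i → F (suc i)) (λ i → G (suc i)) e))
  (swap-middle (F 0 (suc e)) (G 0 (suc e)) _ _)

∑ᵢ₊ⱼ-last : ∀ F e → ∑ᵢ₊ⱼ F (suc e) ≡ ∑ᵢ₊ⱼ (λ i j → F i (suc j)) e ℤ.+ F (suc e) 0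
∑ᵢ₊ⱼ-last F zero = begin
  F 0 1 ℤ.+ (F 1 0 ℤ.+ 0ℤ) ≡⟨ +-congˡ (F 0 1) (ℤ.+-comm (F 1 0) 0ℤ) ⟩
  F 0 1 ℤ.+ (0ℤ ℤ.+ F 1 0) ≡⟨ ℤ.+-assoc (F 0 1) 0ℤ (F 1 0) ⟨
  F 0 1 ℤ.+ 0ℤ ℤ.+ F 1 0   ∎
  where open ≡-Reasoning
∑ᵢ₊ⱼ-last F (suc e) = trans
  (+-congˡ (F 0 (suc (suc e))) (∑ᵢ₊ⱼ-last (λ i → F (suc i)) e))
  (sym (ℤ.+-assoc (F 0 (suc (suc e))) _ _))

∑ᵢ₊ⱼ-swap : ∀ F e → ∑ᵢ₊ⱼ F e ≡ ∑ᵢ₊ⱼ (λ i j → F j i) e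
∑ᵢ₊ⱼ-swap F zero    = refl
∑ᵢ₊ⱼ-swap F (suc e) = begin
  F 0 (suc e) ℤ.+ ∑ᵢ₊ⱼ (λ i → F (suc i)) e       ≡⟨ +-congˡ (F 0 (suc e)) (∑ᵢ₊ⱼ-swap (λ i → F (suc i)) e) ⟩
  F 0 (suc e) ℤ.+ ∑ᵢ₊ⱼ (λ i j → F (suc j) i) e   ≡⟨ ℤ.+-comm (F 0 (suc e)) _ ⟩
  ∑ᵢ₊ⱼ (λ i j → F (suc j) i) e ℤ.+ F 0 (suc e)   ≡⟨ ∑ᵢ₊ⱼ-last (λ i j → F j i) e ⟨
  ∑ᵢ₊ⱼ (λ i j → F j i) (suc e)                   ∎
  where open ≡-Reasoning

∑ᵢ₊ⱼ-assoc : ∀ (F : ℕ → ℕ → ℕ → ℤ) e →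
             ∑ᵢ₊ⱼ (λ h l → ∑ᵢ₊ⱼ (λ i j → F i j l) h) e ≡
             ∑ᵢ₊ⱼ (λ i h → ∑ᵢ₊ⱼ (λ j l → F i j l) h) e
∑ᵢ₊ⱼ-assoc F zero    = refl
∑ᵢ₊ⱼ-assoc F (suc e) = begin
  (F 0 0 (suc e) ℤ.+ 0ℤ) ℤ.+ ∑ᵢ₊ⱼ (λ h l → F 0 (suc h) l ℤ.+ ∑ᵢ₊ⱼ (λ i j → F (suc i) j l) h) e
    ≡⟨ cong₂ ℤ._+_ (ℤ.+-identityʳ (F 0 0 (suc e)))
         (∑ᵢ₊ⱼ-+ (λ h l → F 0 (suc h) l) (λ h l → ∑ᵢ₊ⱼ (λ i j → F (suc i) j l) h) e) ⟩
  F 0 0 (suc e) ℤ.+ (∑ᵢ₊ⱼ (λ h l → F 0 (suc h) l) e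
    ℤ.+ ∑ᵢ₊ⱼ (λ h l → ∑ᵢ₊ⱼ (λ i j → F (suc i) j l) h) e)
    ≡⟨ ℤ.+-assoc (F 0 0 (suc e)) _ _ ⟨
  ∑ᵢ₊ⱼ (F 0) (suc e) ℤ.+ ∑ᵢ₊ⱼ (λ h l → ∑ᵢ₊ⱼ (λ i j → F (suc i) j l) h) e
    ≡⟨ +-congˡ (∑ᵢ₊ⱼ (F 0) (suc e)) (∑ᵢ₊ⱼ-assoc (λ i → F (suc i)) e) ⟩
  ∑ᵢ₊ⱼ (F 0) (suc e) ℤ.+ ∑ᵢ₊ⱼ (λ i h → ∑ᵢ₊ⱼ (λ j l → F (suc i) j l) h) e ∎
  where open ≡-Reasoning

------------------------------------------------------------------------
-- The list e₁ ∷ … ∷ eₖ ∷ [] of exponents stands for the monomial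
-- t₁^e₁ ⋯ tₖ^eₖ, so lists differing by trailing zeros stand for the same
-- monomial.

Monomial : Set
Monomial = List ℕ

Coefficients : Set
Coefficients = Monomial → ℤ

-- f [ i ] is the coefficient of t₁^i in f, as a series in t₂, t₃, …
_[_] : Coefficients → ℕ → Coefficients
(f [ i ]) m = f (i ∷ m)

-- Cauchy product: the coefficient at m is the sum of f a · g b over all
-- factorisations of m into monomials a and b.
mul : Coefficients → Coefficients → Coefficients
mul f g []      = f [] ℤ.* g []
mul f g (e ∷ m) = ∑ᵢ₊ⱼ (λ i j → mul (f [ i ]) (g [ j ]) m) e

one : Coefficients
one []            = 1ℤ
one (zero  ∷ m)   = one m
one (suc _ ∷ _)   = 0ℤ

-- var i is the variable tᵢ₊₁.
var : ℕ → Coefficients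
var _       []              = 0ℤ
var zero    (suc zero ∷ m)  = one m
var zero    (_ ∷ _)         = 0ℤ
var (suc i) (zero ∷ m)      = var i m
var (suc i) (suc _ ∷ _)     = 0ℤ

mul-cong : ∀ {f f′ g g′} → (∀ m → f m ≡ f′ m) → (∀ m → g m ≡ g′ m) →
           ∀ m → mul f g m ≡ mul f′ g′ m
mul-cong f≡ g≡ []      = cong₂ ℤ._*_ (f≡ []) (g≡ [])
mul-cong f≡ g≡ (e ∷ m) =
  ∑ᵢ₊ⱼ-cong (λ i j → mul-cong (λ n → f≡ (i ∷ n)) (λ n → g≡ (j ∷ n)) m) e

mul-comm : ∀ f g m → mul f g m ≡ mul g f m
mul-comm f g []      = ℤ.*-comm (f []) (g [])
mul-comm f g (e ∷ m) = trans
  (∑ᵢ₊ⱼ-cong (λ i j → mul-comm (f [ i ]) (g [ j ]) m) e)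
  (∑ᵢ₊ⱼ-swap (λ i j → mul (g [ j ]) (f [ i ]) m) e)

mul-vanishˡ : ∀ {f} g m → (∀ a → length a ≡ length m → f a ≡ 0ℤ) → mul f g m ≡ 0ℤ
mul-vanishˡ g []      f≡0 = cong (ℤ._* g []) (f≡0 [] refl)
mul-vanishˡ g (e ∷ m) f≡0 =
  ∑ᵢ₊ⱼ-0 (λ i j → mul-vanishˡ (g [ j ]) m (λ a eq → f≡0 (i ∷ a) (cong suc eq))) e

mul-vanishʳ : ∀ f {g} m → (∀ a → length a ≡ length m → g a ≡ 0ℤ) → mul f g m ≡ 0ℤ
mul-vanishʳ f {g} m g≡0 = trans (mul-comm f g m) (mul-vanishˡ f m g≡0)

mul-distribˡ : ∀ f g h m → mul f (λ n → g n ℤ.+ h n) m ≡ mul f g m ℤ.+ mul f h m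
mul-distribˡ f g h []      = ℤ.*-distribˡ-+ (f []) (g []) (h [])
mul-distribˡ f g h (e ∷ m) = trans
  (∑ᵢ₊ⱼ-cong (λ i j → mul-distribˡ (f [ i ]) (g [ j ]) (h [ j ]) m) e)
  (∑ᵢ₊ⱼ-+ (λ i j → mul (f [ i ]) (g [ j ]) m) (λ i j → mul (f [ i ]) (h [ j ]) m) e)

mul-distribʳ : ∀ f g h m → mul (λ n → g n ℤ.+ h n) f m ≡ mul g f m ℤ.+ mul h f m
mul-distribʳ f g h m = begin
  mul (λ n → g n ℤ.+ h n) f m   ≡⟨ mul-comm _ f m ⟩
  mul f (λ n → g n ℤ.+ h n) m   ≡⟨ mul-distribˡ f g h m ⟩
  mul f g m ℤ.+ mul f h m       ≡⟨ cong₂ ℤ._+_ (mul-comm f g m) (mul-comm f h m) ⟩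
  mul g f m ℤ.+ mul h f m       ∎
  where open ≡-Reasoning

mul-∑ᵢ₊ⱼˡ : ∀ (F : ℕ → ℕ → Coefficients) h m e →
            mul (λ n → ∑ᵢ₊ⱼ (λ i j → F i j n) e) h m ≡ ∑ᵢ₊ⱼ (λ i j → mul (F i j) h m) e
mul-∑ᵢ₊ⱼˡ F h m zero = trans
  (mul-distribʳ h (F 0 0) (λ _ → 0ℤ) m)
  (+-congˡ (mul (F 0 0) h m) (mul-vanishˡ h m (λ _ _ → refl)))
mul-∑ᵢ₊ⱼˡ F h m (suc e) = trans
  (mul-distribʳ h (F 0 (suc e)) (λ n → ∑ᵢ₊ⱼ (λ i j → F (suc i) j n) e) m)
  (+-congˡ (mul (F 0 (suc e)) h m) (mul-∑ᵢ₊ⱼˡ (λ i → F (suc i)) h m e))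

mul-assoc : ∀ f g h m → mul (mul f g) h m ≡ mul f (mul g h) m
mul-assoc f g h []      = ℤ.*-assoc (f []) (g []) (h [])
mul-assoc f g h (e ∷ m) = begin
  ∑ᵢ₊ⱼ (λ s l → mul (mul f g [ s ]) (h [ l ]) m) e
    ≡⟨ ∑ᵢ₊ⱼ-cong (λ s l → mul-∑ᵢ₊ⱼˡ (λ i j → mul (f [ i ]) (g [ j ])) (h [ l ]) m s) e ⟩
  ∑ᵢ₊ⱼ (λ s l → ∑ᵢ₊ⱼ (λ i j → mul (mul (f [ i ]) (g [ j ])) (h [ l ]) m) s) e
    ≡⟨ ∑ᵢ₊ⱼ-assoc (λ i j l → mul (mul (f [ i ]) (g [ j ])) (h [ l ]) m) e ⟩
  ∑ᵢ₊ⱼ (λ i s → ∑ᵢ₊ⱼ (λ j l → mul (mul (f [ i ]) (g [ j ])) (h [ l ]) m) s) e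
    ≡⟨ ∑ᵢ₊ⱼ-cong (λ i s → ∑ᵢ₊ⱼ-cong (λ j l → mul-assoc (f [ i ]) (g [ j ]) (h [ l ]) m) s) e ⟩
  ∑ᵢ₊ⱼ (λ i s → ∑ᵢ₊ⱼ (λ j l → mul (f [ i ]) (mul (g [ j ]) (h [ l ])) m) s) e
    ≡⟨ ∑ᵢ₊ⱼ-cong (λ i s → pull (f [ i ]) s) e ⟨
  ∑ᵢ₊ⱼ (λ i s → mul (f [ i ]) (mul g h [ s ]) m) e ∎
  where
  open ≡-Reasoning
  pull : ∀ a s → mul a (mul g h [ s ]) m ≡
                 ∑ᵢ₊ⱼ (λ j l → mul a (mul (g [ j ]) (h [ l ])) m) s
  pull a s = begin
    mul a (mul g h [ s ]) m
      ≡⟨ mul-comm a (mul g h [ s ]) m ⟩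
    mul (mul g h [ s ]) a m
      ≡⟨ mul-∑ᵢ₊ⱼˡ (λ j l → mul (g [ j ]) (h [ l ])) a m s ⟩
    ∑ᵢ₊ⱼ (λ j l → mul (mul (g [ j ]) (h [ l ])) a m) s
      ≡⟨ ∑ᵢ₊ⱼ-cong (λ j l → mul-comm (mul (g [ j ]) (h [ l ])) a m) s ⟩
    ∑ᵢ₊ⱼ (λ j l → mul a (mul (g [ j ]) (h [ l ])) m) s ∎

mul-identityˡ : ∀ f m → mul one f m ≡ f m
mul-identityˡ f []            = ℤ.*-identityˡ (f [])
mul-identityˡ f (zero  ∷ m)   = trans (ℤ.+-identityʳ _) (mul-identityˡ (f [ 0 ]) m)
mul-identityˡ f (suc e ∷ m)   = trans
  (cong₂ ℤ._+_ (mul-identityˡ (f [ suc e ]) m)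
               (∑ᵢ₊ⱼ-0 (λ i j → mul-vanishˡ (f [ j ]) m (λ _ _ → refl)) e))
  (ℤ.+-identityʳ _)

------------------------------------------------------------------------

-- A formal power series over ℤ in t₁, t₂, …: arbitrary coefficients,
-- depending only on the monomial and not on the list representing it.
record Series : Set where
  no-eta-equality
  field
    coeff      : Coefficients
    coeff-∷ʳ0  : ∀ m → coeff (m ∷ʳ 0) ≡ coeff m

open Series public

infix  4 _≈_
infixl 6 _+_
infixl 7 _*_
infix  8 -_

record _≈_ (f g : Series) : Set where
  constructor coeffwise
  field
    at : ∀ m → coeff f m ≡ coeff g m

open _≈_ public

private
  one-∷ʳ0 : ∀ m → one (m ∷ʳ 0) ≡ one m
  one-∷ʳ0 []          = refl
  one-∷ʳ0 (zero  ∷ m) = one-∷ʳ0 m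
  one-∷ʳ0 (suc _ ∷ _) = refl

  var-∷ʳ0 : ∀ i m → var i (m ∷ʳ 0) ≡ var i m
  var-∷ʳ0 zero          []                = refl
  var-∷ʳ0 (suc zero)    []                = refl
  var-∷ʳ0 (suc (suc i)) []                = refl
  var-∷ʳ0 zero          (zero ∷ m)        = refl
  var-∷ʳ0 zero          (suc zero ∷ m)    = one-∷ʳ0 m
  var-∷ʳ0 zero          (suc (suc _) ∷ m) = refl
  var-∷ʳ0 (suc i)       (zero ∷ m)        = var-∷ʳ0 i m
  var-∷ʳ0 (suc i)       (suc _ ∷ m)       = refl

  mul-∷ʳ0 : ∀ f g → (∀ m → f (m ∷ʳ 0) ≡ f m) → (∀ m → g (m ∷ʳ 0) ≡ g m) →
            ∀ m → mul f g (m ∷ʳ 0) ≡ mul f g m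
  mul-∷ʳ0 f g f0 g0 []      = trans (ℤ.+-identityʳ _) (cong₂ ℤ._*_ (f0 []) (g0 []))
  mul-∷ʳ0 f g f0 g0 (e ∷ m) = ∑ᵢ₊ⱼ-cong
    (λ i j → mul-∷ʳ0 (f [ i ]) (g [ j ]) (λ n → f0 (i ∷ n)) (λ n → g0 (j ∷ n)) m) e

_+_ _*_ : Series → Series → Series
coeff     (f + g) m = coeff f m ℤ.+ coeff g m
coeff-∷ʳ0 (f + g) m = cong₂ ℤ._+_ (coeff-∷ʳ0 f m) (coeff-∷ʳ0 g m)
coeff     (f * g)   = mul (coeff f) (coeff g)
coeff-∷ʳ0 (f * g)   = mul-∷ʳ0 (coeff f) (coeff g) (coeff-∷ʳ0 f) (coeff-∷ʳ0 g)

-_ : Series → Series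
coeff     (- f) m = ℤ.- coeff f m
coeff-∷ʳ0 (- f) m = cong ℤ.-_ (coeff-∷ʳ0 f m)

0# 1# : Series
coeff     0# _ = 0ℤ
coeff-∷ʳ0 0# _ = refl
coeff     1#   = one
coeff-∷ʳ0 1#   = one-∷ʳ0

-- t[1+ i ] is the variable tᵢ₊₁.
t[1+_] : ℕ → Series
coeff     t[1+ i ] = var i
coeff-∷ʳ0 t[1+ i ] = var-∷ʳ0 i

≈-isEquivalence : IsEquivalence _≈_
≈-isEquivalence = record
  { refl  = coeffwise λ _ → refl
  ; sym   = λ p → coeffwise λ m → sym (at p m)
  ; trans = λ p q → coeffwise λ m → trans (at p m) (at q m)
  }

seriesRing : CommutativeRing 0ℓ 0ℓ
seriesRing = record
  { Carrier = Series ; _≈_ = _≈_ ; _+_ = _+_ ; _*_ = _*_ ; -_ = -_ ; 0# = 0# ; 1# = 1#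
  ; isCommutativeRing = record
    { isRing = record
      { +-isAbelianGroup = record
        { isGroup = record
          { isMonoid = record
            { isSemigroup = record
              { isMagma = record
                { isEquivalence = ≈-isEquivalence
                ; ∙-cong = λ p q → coeffwise λ m → cong₂ ℤ._+_ (at p m) (at q m)
                }
              ; assoc = λ f g h → coeffwise λ m → ℤ.+-assoc (coeff f m) (coeff g m) (coeff h m)
              }
            ; identity = (λ f → coeffwise λ m → ℤ.+-identityˡ (coeff f m))
                       , (λ f → coeffwise λ m → ℤ.+-identityʳ (coeff f m))
            }
          ; inverse = (λ f → coeffwise λ m → ℤ.+-inverseˡ (coeff f m))
                    , (λ f → coeffwise λ m → ℤ.+-inverseʳ (coeff f m))
          ; ⁻¹-cong = λ p → coeffwise λ m → cong ℤ.-_ (at p m)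
          }
        ; comm = λ f g → coeffwise λ m → ℤ.+-comm (coeff f m) (coeff g m)
        }
      ; *-cong     = λ p q → coeffwise (mul-cong (at p) (at q))
      ; *-assoc    = λ f g h → coeffwise (mul-assoc (coeff f) (coeff g) (coeff h))
      ; *-identity = (λ f → coeffwise (mul-identityˡ (coeff f)))
                   , (λ f → coeffwise λ m →
                        trans (mul-comm (coeff f) one m) (mul-identityˡ (coeff f) m))
      ; distrib    = (λ f g h → coeffwise (mul-distribˡ (coeff f) (coeff g) (coeff h)))
                   , (λ f g h → coeffwise (mul-distribʳ (coeff f) (coeff g) (coeff h)))
      }
    ; *-comm = λ f g → coeffwise (mul-comm (coeff f) (coeff g))
    }
  }

module SeriesRing = CommutativeRing seriesRing
open SeriesRing public using (_-_; _≉_)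

open import Algebra.Properties.Semiring.Exp SeriesRing.semiring public using (_^_)

module SeriesSum = Algebra.Properties.Semiring.Sum SeriesRing.semiring

-- ∑< n F is F 0 + F 1 + ⋯ + F (n - 1).
∑< : ℕ → (ℕ → Series) → Series
∑< n F = SeriesSum.sum {n} (λ i → F (toℕ i))

------------------------------------------------------------------------

private
  NonVanishing : ℕ → Coefficients → Set
  NonVanishing k f = ∃[ a ] length a ≡ k × f a ≢ 0ℤ

  vanishing : ∀ {k f} → ¬ NonVanishing k f → ∀ a → length a ≡ k → f a ≡ 0ℤ
  vanishing {f = f} ¬nv a |a|≡k =
    decidable-stable (f a ℤ.≟ 0ℤ) (λ fa≢0 → ¬nv (a , |a|≡k , fa≢0))

  -- f ⁺ is (f - f(0, t₂, t₃, …)) / t₁.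
  _⁺ : Coefficients → Coefficients
  (f ⁺) []      = 0ℤ
  (f ⁺) (e ∷ m) = f (suc e ∷ m)

  mutual
    mul-nonVanishing : ∀ k f g → NonVanishing k f → NonVanishing k g →
                       ¬ ¬ NonVanishing k (mul f g)
    mul-nonVanishing zero f g ([] , _ , f≢0) ([] , _ , g≢0) ¬nv =
      ¬nv ([] , refl , λ fg≡0 → [ f≢0 , g≢0 ]′ (ℤ.i*j≡0⇒i≡0∨j≡0 (f []) fg≡0))
    mul-nonVanishing (suc k) f g (e ∷ a , refl , f≢0) (e′ ∷ b , |b| , g≢0) =
      mul-nonVanishing-∷ k f g e e′ (a , refl , f≢0) (b , ℕ.suc-injective |b| , g≢0)

    mul-nonVanishing-∷ : ∀ k f g e e′ →
                         NonVanishing k (f [ e ]) → NonVanishing k (g [ e′ ]) →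
                         ¬ ¬ NonVanishing (suc k) (mul f g)
    mul-nonVanishing-∷ k f g e e′ fₑ gₑ ¬nv =
      ¬f₀≡0 e fₑ (λ f₀ → ¬g₀≡0 e′ gₑ (λ g₀ →
        mul-nonVanishing k (f [ 0 ]) (g [ 0 ]) f₀ g₀ λ where
          (c , refl , fg≢0) → ¬nv (0 ∷ c , refl , λ eq →
            fg≢0 (trans (sym (ℤ.+-identityʳ _)) eq))))
      where
      open ≡-Reasoning
      ¬f₀≡0 : ∀ e → NonVanishing k (f [ e ]) → ¬ ¬ NonVanishing k (f [ 0 ])
      ¬f₀≡0 zero    f₀ ¬f₀ = ¬f₀ f₀
      ¬f₀≡0 (suc e) fₑ ¬f₀ = mul-nonVanishing-∷ k (f ⁺) g e e′ fₑ gₑ λ where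
        ([]    , () , _)
        (h ∷ c , refl , fg≢0) → ¬nv (suc h ∷ c , refl , λ eq → fg≢0 (begin
          mul (f ⁺) g (h ∷ c)
            ≡⟨ ℤ.+-identityˡ _ ⟨
          0ℤ ℤ.+ mul (f ⁺) g (h ∷ c)
            ≡⟨ cong (ℤ._+ mul (f ⁺) g (h ∷ c)) (mul-vanishˡ (g [ suc h ]) c (vanishing ¬f₀)) ⟨
          mul f g (suc h ∷ c)
            ≡⟨ eq ⟩
          0ℤ ∎))
      ¬g₀≡0 : ∀ e′ → NonVanishing k (g [ e′ ]) → ¬ ¬ NonVanishing k (g [ 0 ])
      ¬g₀≡0 zero     g₀ ¬g₀ = ¬g₀ g₀
      ¬g₀≡0 (suc e′) gₑ ¬g₀ = mul-nonVanishing-∷ k f (g ⁺) e e′ fₑ gₑ λ where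
        ([]    , () , _)
        (h ∷ c , refl , fg≢0) → ¬nv (suc h ∷ c , refl , λ eq → fg≢0 (begin
          mul f (g ⁺) (h ∷ c)
            ≡⟨ ℤ.+-identityʳ _ ⟨
          mul f (g ⁺) (h ∷ c) ℤ.+ 0ℤ
            ≡⟨ +-congˡ (mul f (g ⁺) (h ∷ c)) (mul-vanishʳ (f [ suc h ]) c (vanishing ¬g₀)) ⟨
          mul f (g ⁺) (h ∷ c) ℤ.+ mul (f [ suc h ]) (g [ 0 ]) c
            ≡⟨ ∑ᵢ₊ⱼ-last (λ i j → mul (f [ i ]) (g [ j ]) c) h ⟨
          mul f g (suc h ∷ c)
            ≡⟨ eq ⟩
          0ℤ ∎))

  pad : Monomial → ℕ → Monomial
  pad m zero    = m
  pad m (suc n) = pad (m ∷ʳ 0) n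

  length-pad : ∀ m n → length (pad m n) ≡ length m ℕ.+ n
  length-pad m zero    = sym (ℕ.+-identityʳ _)
  length-pad m (suc n) = begin
    length (pad (m ∷ʳ 0) n)   ≡⟨ length-pad (m ∷ʳ 0) n ⟩
    length (m ∷ʳ 0) ℕ.+ n     ≡⟨ cong (ℕ._+ n) (length-++ m) ⟩
    length m ℕ.+ 1 ℕ.+ n      ≡⟨ ℕ.+-assoc (length m) 1 n ⟩
    length m ℕ.+ suc n        ∎
    where open ≡-Reasoning

  coeff-pad : ∀ f m n → coeff f (pad m n) ≡ coeff f m
  coeff-pad f m zero    = refl
  coeff-pad f m (suc n) = trans (coeff-pad f (m ∷ʳ 0) n) (coeff-∷ʳ0 f m)

*-cancelˡ-nonZero : AlgebraDefinitions.AlmostLeftCancellative _≈_ 0# _*_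
*-cancelˡ-nonZero x y z x≉0 xy≈xz = coeffwise λ m →
  decidable-stable (coeff y m ℤ.≟ coeff z m) λ yₘ≢zₘ → x≉0 (coeffwise λ a →
  decidable-stable (coeff x a ℤ.≟ 0ℤ) λ xₐ≢0 →
  mul-nonVanishing (length a ℕ.+ length m) (coeff x) (coeff (y - z))
    (pad a (length m) , length-pad a (length m) ,
      λ eq → xₐ≢0 (trans (sym (coeff-pad x a (length m))) eq))
    (pad m (length a) , trans (length-pad m (length a)) (ℕ.+-comm (length m) (length a)) ,
      λ eq → yₘ≢zₘ (ℤ.i-j≡0⇒i≡j (coeff y m) (coeff z m)
        (trans (sym (coeff-pad (y - z) m (length a))) eq)))
    (λ (c , _ , ≢0) → ≢0 (at x[y-z]≈0 c)))
  where
  open import Algebra.Properties.Ring SeriesRing.ring using (x[y-z]≈xy-xz)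
  open import Algebra.Properties.Group SeriesRing.+-group using (x≈y⇒x∙y⁻¹≈ε)
  x[y-z]≈0 : x * (y - z) ≈ 0#
  x[y-z]≈0 = SeriesRing.trans (x[y-z]≈xy-xz x y z) (x≈y⇒x∙y⁻¹≈ε xy≈xz)

1≉0 : 1# ≉ 0#
1≉0 1≈0 with () ← at 1≈0 []

------------------------------------------------------------------------

-- Every monomial has a nonzero coefficient in only finitely many of the F i.
record LocallyFinite (F : ℕ → Series) : Set where
  field
    bound    : Monomial → ℕ
    vanishes : ∀ m i → bound m ≤ i → coeff (F i) m ≡ 0ℤ

private
  partial : (ℕ → ℤ) → ℕ → ℤ
  partial a n = ∑[ i < n ] a (toℕ i)

  partial-0 : ∀ a n → (∀ i → a i ≡ 0ℤ) → partial a n ≡ 0ℤ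
  partial-0 a zero    a≡0 = refl
  partial-0 a (suc n) a≡0 = cong₂ ℤ._+_ (a≡0 0) (partial-0 (λ i → a (suc i)) n (λ i → a≡0 (suc i)))

  partial-cong : ∀ {a b} n → (∀ i → a i ≡ b i) → partial a n ≡ partial b n
  partial-cong zero    a≡b = refl
  partial-cong (suc n) a≡b = cong₂ ℤ._+_ (a≡b 0) (partial-cong n (λ i → a≡b (suc i)))

  partial-stable : ∀ a m n → (∀ i → m ≤ i → a i ≡ 0ℤ) → (∀ i → n ≤ i → a i ≡ 0ℤ) →
                   partial a m ≡ partial a n
  partial-stable a zero    n       a≡0 _   = sym (partial-0 a n (λ i → a≡0 i z≤n))
  partial-stable a (suc m) zero    _   a≡0 = partial-0 a (suc m) (λ i → a≡0 i z≤n)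
  partial-stable a (suc m) (suc n) p   q   = +-congˡ (a 0)
    (partial-stable (λ i → a (suc i)) m n (λ i m≤i → p (suc i) (s≤s m≤i)) (λ i n≤i → q (suc i) (s≤s n≤i)))

-- ∑ F is F 0 + F 1 + F 2 + ⋯; its value does not depend on the choice of bounds.
∑ : (F : ℕ → Series) → {{LocallyFinite F}} → Series
coeff     (∑ F {{fin}}) m = ∑[ i < LocallyFinite.bound fin m ] coeff (F (toℕ i)) m
coeff-∷ʳ0 (∑ F {{fin}}) m = trans
  (partial-cong (bound (m ∷ʳ 0)) (λ i → coeff-∷ʳ0 (F i) m))
  (partial-stable (λ i → coeff (F i) m) (bound (m ∷ʳ 0)) (bound m)
    (λ i ≤i → trans (sym (coeff-∷ʳ0 (F i) m)) (vanishes (m ∷ʳ 0) i ≤i))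
    (vanishes m))
  where open LocallyFinite fin

private
  var-vanishes : ∀ m i → length m ≤ i → var i m ≡ 0ℤ
  var-vanishes []          zero    _         = refl
  var-vanishes []          (suc i) _         = refl
  var-vanishes (zero  ∷ m) (suc i) (s≤s m≤i) = var-vanishes m i m≤i
  var-vanishes (suc _ ∷ m) (suc i) _         = refl

  var-mul-vanishes : ∀ f m i → length m ≤ i → mul (var i) f m ≡ 0ℤ
  var-mul-vanishes f m i m≤i = mul-vanishˡ f m λ a |a|≡|m| →
    var-vanishes a i (subst (_≤ i) (sym |a|≡|m|) m≤i)

instance
  t-locallyFinite : LocallyFinite t[1+_]
  t-locallyFinite = record { bound = length ; vanishes = var-vanishes }

  t*-locallyFinite : ∀ {F : ℕ → Series} → LocallyFinite (λ i → t[1+ i ] * F i)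
  t*-locallyFinite {F} = record
    { bound    = length
    ; vanishes = λ m i → var-mul-vanishes (coeff (F i)) m i
    }

  t⁺*-locallyFinite : ∀ {F : ℕ → Series} → LocallyFinite (λ i → t[1+ suc i ] * F i)
  t⁺*-locallyFinite {F} = record
    { bound    = length
    ; vanishes = λ m i m≤i → var-mul-vanishes (coeff (F i)) m (suc i) (ℕ.m≤n⇒m≤1+n m≤i)
    }

------------------------------------------------------------------------

module FractionField
  {c ℓ} (R : CommutativeRing c ℓ)
  (1≉0 : ¬ CommutativeRing._≈_ R (CommutativeRing.1# R) (CommutativeRing.0# R))
  (cancel : AlgebraDefinitions.AlmostLeftCancellative
              (CommutativeRing._≈_ R) (CommutativeRing.0# R) (CommutativeRing._*_ R))
  where

  private
    module R = CommutativeRing R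
    open import Algebra.Properties.Ring R.ring using (-‿distribˡ-*)
    open import Algebra.Solver.Ring.NaturalCoefficients.Default R.commutativeSemiring
    open import Relation.Binary.Reasoning.Setoid R.setoid

  open CommutativeRing R using (Carrier)
    renaming (_≈_ to _≈ᴿ_; _≉_ to _≉ᴿ_; _+_ to _+ᴿ_; _*_ to _*ᴿ_; -_ to -ᴿ_; 0# to 0ᴿ; 1# to 1ᴿ)

  infix  4 _≃_ _≄_ _≃_⁻¹
  infixl 6 _+ᶠ_ _-ᶠ_
  infixl 7 _*ᶠ_
  infix  8 -ᶠ_

  *-nonZero : ∀ {x y} → x ≉ᴿ 0ᴿ → y ≉ᴿ 0ᴿ → x *ᴿ y ≉ᴿ 0ᴿ
  *-nonZero {x} {y} x≉0 y≉0 xy≈0 = y≉0 (cancel x y 0ᴿ x≉0 (R.trans xy≈0 (R.sym (R.zeroʳ x))))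

  record Fraction : Set (c ⊔ ℓ) where
    constructor _/_⟨_⟩
    field
      num   : Carrier
      den   : Carrier
      den≉0 : den ≉ᴿ 0ᴿ

  open Fraction public

  record _≃_ (x y : Fraction) : Set ℓ where
    constructor *≃*
    field
      cross : num x *ᴿ den y ≈ᴿ num y *ᴿ den x

  open _≃_ public

  _≄_ : Fraction → Fraction → Set ℓ
  x ≄ y = ¬ x ≃ y

  ι : Carrier → Fraction
  ι a = a / 1ᴿ ⟨ 1≉0 ⟩

  0ᶠ 1ᶠ : Fraction
  0ᶠ = ι 0ᴿ
  1ᶠ = ι 1ᴿ

  _+ᶠ_ _*ᶠ_ : Fraction → Fraction → Fraction
  (a / b ⟨ b≉0 ⟩) +ᶠ (c / d ⟨ d≉0 ⟩) = (a *ᴿ d +ᴿ c *ᴿ b) / b *ᴿ d ⟨ *-nonZero b≉0 d≉0 ⟩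
  (a / b ⟨ b≉0 ⟩) *ᶠ (c / d ⟨ d≉0 ⟩) = (a *ᴿ c) / b *ᴿ d ⟨ *-nonZero b≉0 d≉0 ⟩

  -ᶠ_ : Fraction → Fraction
  -ᶠ (a / b ⟨ b≉0 ⟩) = (-ᴿ a) / b ⟨ b≉0 ⟩

  _-ᶠ_ : Fraction → Fraction → Fraction
  x -ᶠ y = x +ᶠ (-ᶠ y)

  ≃-isEquivalence : IsEquivalence _≃_
  ≃-isEquivalence = record
    { refl  = *≃* R.refl
    ; sym   = λ p → *≃* (R.sym (cross p))
    ; trans = λ {x} {y} {z} p q → *≃* (cancel (den y) _ _ (den≉0 y) (begin
        den y *ᴿ (num x *ᴿ den z) ≈⟨ solve 3 (λ a b c → a :* (b :* c) := (b :* a) :* c) R.refl (den y) (num x) (den z) ⟩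
        (num x *ᴿ den y) *ᴿ den z ≈⟨ R.*-congʳ (cross p) ⟩
        (num y *ᴿ den x) *ᴿ den z ≈⟨ solve 3 (λ a b c → (a :* b) :* c := (a :* c) :* b) R.refl (num y) (den x) (den z) ⟩
        (num y *ᴿ den z) *ᴿ den x ≈⟨ R.*-congʳ (cross q) ⟩
        (num z *ᴿ den y) *ᴿ den x ≈⟨ solve 3 (λ a b c → (a :* b) :* c := b :* (a :* c)) R.refl (num z) (den y) (den x) ⟩
        den y *ᴿ (num z *ᴿ den x) ∎))
    }

  fractionRing : CommutativeRing (c ⊔ ℓ) ℓ
  fractionRing = record
    { Carrier = Fraction ; _≈_ = _≃_ ; _+_ = _+ᶠ_ ; _*_ = _*ᶠ_ ; -_ = -ᶠ_ ; 0# = 0ᶠ ; 1# = 1ᶠ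
    ; isCommutativeRing = record
      { isRing = record
        { +-isAbelianGroup = record
          { isGroup = record
            { isMonoid = record
              { isSemigroup = record
                { isMagma = record { isEquivalence = ≃-isEquivalence ; ∙-cong = +-cong }
                ; assoc = λ (a / b ⟨ _ ⟩) (c / d ⟨ _ ⟩) (e / f ⟨ _ ⟩) → *≃* (solve 6
                    (λ a b c d e f → ((a :* d :+ c :* b) :* f :+ e :* (b :* d)) :* (b :* (d :* f))
                                  := (a :* (d :* f) :+ (c :* f :+ e :* d) :* b) :* ((b :* d) :* f))
                    R.refl a b c d e f)
                }
              ; identity = (λ (a / b ⟨ _ ⟩) → *≃* (solve 2
                    (λ a b → (con 0 :* b :+ a :* con 1) :* b := a :* (con 1 :* b)) R.refl a b))
                         , (λ (a / b ⟨ _ ⟩) → *≃* (solve 2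
                    (λ a b → (a :* con 1 :+ con 0 :* b) :* b := a :* (b :* con 1)) R.refl a b))
              }
            ; inverse = -ᶠ-inverseˡ
                      , (λ x → ≃-trans (+ᶠ-comm x (-ᶠ x)) (-ᶠ-inverseˡ x))
            ; ⁻¹-cong = λ p → *≃* (begin
                _ ≈⟨ -‿distribˡ-* _ _ ⟨
                _ ≈⟨ R.-‿cong (cross p) ⟩
                _ ≈⟨ -‿distribˡ-* _ _ ⟩
                _ ∎)
            }
          ; comm = +ᶠ-comm
          }
        ; *-cong = *-cong
        ; *-assoc = λ (a / b ⟨ _ ⟩) (c / d ⟨ _ ⟩) (e / f ⟨ _ ⟩) → *≃* (solve 6
            (λ a b c d e f → ((a :* c) :* e) :* (b :* (d :* f))
                          := (a :* (c :* e)) :* ((b :* d) :* f)) R.refl a b c d e f)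
        ; *-identity = *ᶠ-identityˡ
                     , (λ x → ≃-trans (*ᶠ-comm x 1ᶠ) (*ᶠ-identityˡ x))
        ; distrib = *ᶠ-distribˡ
                  , (λ x y z → ≃-trans (*ᶠ-comm (y +ᶠ z) x)
                      (≃-trans (*ᶠ-distribˡ x y z) (+-cong (*ᶠ-comm x y) (*ᶠ-comm x z))))
        }
      ; *-comm = *ᶠ-comm
      }
    }
    where
    open IsEquivalence ≃-isEquivalence using () renaming (trans to ≃-trans)

    +-cong : ∀ {x x′ y y′} → x ≃ x′ → y ≃ y′ → x +ᶠ y ≃ x′ +ᶠ y′
    +-cong {a / b ⟨ _ ⟩} {a′ / b′ ⟨ _ ⟩} {c / d ⟨ _ ⟩} {c′ / d′ ⟨ _ ⟩} p q = *≃* (begin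
      (a *ᴿ d +ᴿ c *ᴿ b) *ᴿ (b′ *ᴿ d′)
        ≈⟨ solve 6 (λ a b c d b′ d′ → (a :* d :+ c :* b) :* (b′ :* d′)
             := (a :* b′) :* (d :* d′) :+ (c :* d′) :* (b :* b′)) R.refl a b c d b′ d′ ⟩
      (a *ᴿ b′) *ᴿ (d *ᴿ d′) +ᴿ (c *ᴿ d′) *ᴿ (b *ᴿ b′)
        ≈⟨ R.+-cong (R.*-congʳ (cross p)) (R.*-congʳ (cross q)) ⟩
      (a′ *ᴿ b) *ᴿ (d *ᴿ d′) +ᴿ (c′ *ᴿ d) *ᴿ (b *ᴿ b′)
        ≈⟨ solve 6 (λ a′ b c′ d b′ d′ → (a′ :* b) :* (d :* d′) :+ (c′ :* d) :* (b :* b′)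
             := (a′ :* d′ :+ c′ :* b′) :* (b :* d)) R.refl a′ b c′ d b′ d′ ⟩
      (a′ *ᴿ d′ +ᴿ c′ *ᴿ b′) *ᴿ (b *ᴿ d) ∎)

    *-cong : ∀ {x x′ y y′} → x ≃ x′ → y ≃ y′ → x *ᶠ y ≃ x′ *ᶠ y′
    *-cong {a / b ⟨ _ ⟩} {a′ / b′ ⟨ _ ⟩} {c / d ⟨ _ ⟩} {c′ / d′ ⟨ _ ⟩} p q = *≃* (begin
      (a *ᴿ c) *ᴿ (b′ *ᴿ d′)
        ≈⟨ solve 4 (λ a b c d → (a :* b) :* (c :* d) := (a :* c) :* (b :* d)) R.refl a c b′ d′ ⟩
      (a *ᴿ b′) *ᴿ (c *ᴿ d′)
        ≈⟨ R.*-cong (cross p) (cross q) ⟩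
      (a′ *ᴿ b) *ᴿ (c′ *ᴿ d)
        ≈⟨ solve 4 (λ a b c d → (a :* b) :* (c :* d) := (a :* c) :* (b :* d)) R.refl a′ b c′ d ⟩
      (a′ *ᴿ c′) *ᴿ (b *ᴿ d) ∎)

    +ᶠ-comm : ∀ x y → x +ᶠ y ≃ y +ᶠ x
    +ᶠ-comm (a / b ⟨ _ ⟩) (c / d ⟨ _ ⟩) = *≃* (solve 4
      (λ a b c d → (a :* d :+ c :* b) :* (d :* b) := (c :* b :+ a :* d) :* (b :* d)) R.refl a b c d)

    *ᶠ-comm : ∀ x y → x *ᶠ y ≃ y *ᶠ x
    *ᶠ-comm (a / b ⟨ _ ⟩) (c / d ⟨ _ ⟩) = *≃* (solve 4
      (λ a b c d → (a :* c) :* (d :* b) := (c :* a) :* (b :* d)) R.refl a b c d)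

    *ᶠ-identityˡ : ∀ x → 1ᶠ *ᶠ x ≃ x
    *ᶠ-identityˡ (a / b ⟨ _ ⟩) = *≃* (solve 2
      (λ a b → (con 1 :* a) :* b := a :* (con 1 :* b)) R.refl a b)

    *ᶠ-distribˡ : ∀ x y z → x *ᶠ (y +ᶠ z) ≃ (x *ᶠ y) +ᶠ (x *ᶠ z)
    *ᶠ-distribˡ (a / b ⟨ _ ⟩) (c / d ⟨ _ ⟩) (e / f ⟨ _ ⟩) = *≃* (solve 6
      (λ a b c d e f → (a :* (c :* f :+ e :* d)) :* ((b :* d) :* (b :* f))
                    := ((a :* c) :* (b :* f) :+ (a :* e) :* (b :* d)) :* (b :* (d :* f)))
      R.refl a b c d e f)

    -ᶠ-inverseˡ : ∀ x → (-ᶠ x) +ᶠ x ≃ 0ᶠ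
    -ᶠ-inverseˡ (a / b ⟨ _ ⟩) = *≃* (begin
      ((-ᴿ a) *ᴿ b +ᴿ a *ᴿ b) *ᴿ 1ᴿ ≈⟨ R.*-identityʳ _ ⟩
      (-ᴿ a) *ᴿ b +ᴿ a *ᴿ b         ≈⟨ R.distribʳ b (-ᴿ a) a ⟨
      ((-ᴿ a) +ᴿ a) *ᴿ b            ≈⟨ R.*-congʳ (R.-‿inverseˡ a) ⟩
      0ᴿ *ᴿ b                       ≈⟨ R.zeroˡ b ⟩
      0ᴿ                            ≈⟨ R.zeroˡ (b *ᴿ b) ⟨
      0ᴿ *ᴿ (b *ᴿ b)                ∎)

  inv : (x : Fraction) → x ≄ 0ᶠ → Fraction
  inv (a / b ⟨ b≉0 ⟩) x≄0 = b / a ⟨ (λ a≈0 → x≄0 (*≃* (begin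
    a *ᴿ 1ᴿ   ≈⟨ R.*-identityʳ a ⟩
    a         ≈⟨ a≈0 ⟩
    0ᴿ        ≈⟨ R.zeroˡ b ⟨
    0ᴿ *ᴿ b   ∎))) ⟩

  inv-inverseʳ : ∀ x (x≄0 : x ≄ 0ᶠ) → x *ᶠ inv x x≄0 ≃ 1ᶠ
  inv-inverseʳ (a / b ⟨ _ ⟩) _ = *≃* (solve 2
    (λ a b → (a :* b) :* con 1 := con 1 :* (b :* a)) R.refl a b)

  ι-≄0 : ∀ {a} → a ≉ᴿ 0ᴿ → ι a ≄ 0ᶠ
  ι-≄0 {a} a≉0 p = a≉0 (begin
    a         ≈⟨ R.*-identityʳ a ⟨
    a *ᴿ 1ᴿ   ≈⟨ cross p ⟩
    0ᴿ *ᴿ 1ᴿ  ≈⟨ R.zeroˡ 1ᴿ ⟩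
    0ᴿ        ∎)

  div : Fraction → (y : Fraction) → y ≄ 0ᶠ → Fraction
  div x y y≄0 = x *ᶠ inv y y≄0

  -- Inversion being partial, x ≃ y ⁻¹ includes the assertion that y is nonzero.
  _≃_⁻¹ : Fraction → Fraction → Set ℓ
  x ≃ y ⁻¹ = Σ[ y≄0 ∈ y ≄ 0ᶠ ] x ≃ inv y y≄0

open FractionField seriesRing 1≉0 *-cancelˡ-nonZero public

------------------------------------------------------------------------

S₁ : Series
S₁ = ∑ t[1+_]

S₁≉0 : S₁ ≉ 0#
S₁≉0 S₁≈0 with () ← at S₁≈0 (1 ∷ [])

-- The constant term of a solution is 1.
S≉0 : ∀ {S} → S ≈ 1# + ∑ (λ i → t[1+ i ] * S ^ suc i) → S ≉ 0#
S≉0 S-eq S≈0 with () ← trans (sym (at S-eq [])) (at S≈0 [])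

{-# OPTIONS --safe #-}

-- Write P = ∑ tₙ Sⁿ⁻¹, Q = ∑ tₙ (1 + S + ⋯ + Sⁿ⁻¹) and R = ∑ tₙ (S + ⋯ + Sⁿ⁻¹).
-- The equation for S says S - 1 = S P, that is S (1 - P) = 1, and H S₁ = (S - 1) / S = P.  By the geometric sum
-- (S - 1)(1 + ⋯ + Sⁿ⁻¹) = Sⁿ - 1 it also gives (S - 1) Q = (S - 1) - S₁, that is
-- (S - 1)(1 - Q) = S₁, and Q = S₁ + R turns this into (S - 1)(1 - R) = S S₁.
-- Dividing the last two identities by S₁ and S S₁ gives the formulas for G and H.
module Submission where

open import Algebra.Bundles using (CommutativeRing)
open import Data.Fin.Base using (toℕ)
open import Data.Integer.Base as ℤ using (ℤ; 0ℤ)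
open import Data.List.Base using ([]; _∷_; length)
open import Data.Nat.Base using (ℕ; zero; suc; _≤_; z≤n; s≤s; _⊔_)
import Data.Nat.Properties as ℕ
open import Data.Product.Base using (_×_; _,_)
open import Function.Base using (_∘_)
open import Relation.Binary.PropositionalEquality using (_≡_; refl; sym; trans; cong; cong₂)
open import Defs

open ℤ-Sum using (sum-syntax)
open LocallyFinite {{...}}
open SeriesRing using (+-cong; +-congˡ; +-congʳ; *-congˡ; *-congʳ)
open import Algebra.Properties.Ring SeriesRing.ring using (x[y-z]≈xy-xz)
open import Algebra.Properties.CommutativeSemigroup SeriesRing.*-commutativeSemigroup
  using (x∙yz≈y∙xz)
open import Algebra.Properties.AbelianGroup SeriesRing.+-abelianGroup
  using (xyx⁻¹≈y; //-rightDividesˡ; ⁻¹-anti-homo-//)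
import Relation.Binary.Reasoning.Setoid SeriesRing.setoid as ≈-Reasoning

module ℱ = CommutativeRing fractionRing

-- Infinite sums of series through finite truncations.

sum-truncate : ∀ (a : ℕ → ℤ) {b n} → b ≤ n → (∀ i → b ≤ i → a i ≡ 0ℤ) →
               ∑[ i < b ] a (toℕ i) ≡ ∑[ i < n ] a (toℕ i)
sum-truncate a {n = zero}  z≤n       a≡0 = refl
sum-truncate a {n = suc n} z≤n       a≡0 =
  cong₂ ℤ._+_ (sym (a≡0 0 z≤n)) (sum-truncate (a ∘ suc) {n = n} z≤n (λ i _ → a≡0 (suc i) z≤n))
sum-truncate a             (s≤s b≤n) a≡0 =
  cong (ℤ._+_ (a 0)) (sum-truncate (a ∘ suc) b≤n (λ i b≤i → a≡0 (suc i) (s≤s b≤i)))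

coeff-∑< : ∀ n F m → coeff (∑< n F) m ≡ ∑[ i < n ] coeff (F (toℕ i)) m
coeff-∑< zero    F m = refl
coeff-∑< (suc n) F m = cong (ℤ._+_ (coeff (F 0) m)) (coeff-∑< n (F ∘ suc) m)

-- Any `n` past the bound will do, so families with different bounds can be compared, one
-- coefficient at a time, at a common truncation, where the laws of finite sums apply.
coeff-∑ : ∀ F {{_ : LocallyFinite F}} m {n} → bound {F} m ≤ n →
          coeff (∑ F) m ≡ coeff (∑< n F) m
coeff-∑ F m {n} b≤n =
  trans (sum-truncate (λ i → coeff (F i) m) b≤n (vanishes m)) (sym (coeff-∑< n F m))

∑-cong : ∀ {F G} {{_ : LocallyFinite F}} {{_ : LocallyFinite G}} →
         (∀ i → F i ≈ G i) → ∑ F ≈ ∑ G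
∑-cong {F} {G} F≈G = coeffwise λ m → trans
  (coeff-∑ F m (ℕ.m≤m⊔n _ (bound {G} m)))
  (trans (at (SeriesSum.sum-cong-≋ {bound {F} m ⊔ bound {G} m} (F≈G ∘ toℕ)) m)
  (sym (coeff-∑ G m (ℕ.m≤n⊔m (bound {F} m) _))))

∑-+ : ∀ F G {{_ : LocallyFinite F}} {{_ : LocallyFinite G}}
      {{_ : LocallyFinite (λ i → F i + G i)}} →
      ∑ (λ i → F i + G i) ≈ ∑ F + ∑ G
∑-+ F G = coeffwise λ m →
  let b = bound {λ i → F i + G i} m
      c = bound {F} m
      d = bound {G} m
  in trans
    (coeff-∑ (λ i → F i + G i) m (ℕ.m≤m⊔n b (c ⊔ d)))
    (trans (at (SeriesSum.∑-distrib-+ {b ⊔ (c ⊔ d)} (F ∘ toℕ) (G ∘ toℕ)) m)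
    (sym (cong₂ ℤ._+_
      (coeff-∑ F m (ℕ.≤-trans (ℕ.m≤m⊔n c d) (ℕ.m≤n⊔m b (c ⊔ d))))
      (coeff-∑ G m (ℕ.≤-trans (ℕ.m≤n⊔m c d) (ℕ.m≤n⊔m b (c ⊔ d)))))))

∑-head : ∀ F {{_ : LocallyFinite F}} {{_ : LocallyFinite (F ∘ suc)}} →
         ∑ F ≈ F 0 + ∑ (F ∘ suc)
∑-head F = coeffwise λ m → trans
  -- The truncation point is one more than the larger of the two bounds: the successor exposes
  -- `F 0`, and what remains truncates the tail.
  (coeff-∑ F m (ℕ.m≤n⇒m≤1+n (ℕ.m≤m⊔n (bound {F} m) (bound {F ∘ suc} m))))
  (cong (ℤ._+_ (coeff (F 0) m)) (sym (coeff-∑ (F ∘ suc) m (ℕ.m≤n⊔m (bound {F} m) _))))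

-- In the Cauchy product both factors of `m` are lists as long as `m`, so no other coefficients of
-- `g` enter.
mul-congʳ-length : ∀ f {g g′} m → (∀ a → length a ≡ length m → g a ≡ g′ a) →
                   mul f g m ≡ mul f g′ m
mul-congʳ-length f []      g≡g′ = cong (ℤ._*_ (f [])) (g≡g′ [] refl)
mul-congʳ-length f (e ∷ m) g≡g′ = ∑ᵢ₊ⱼ-cong
  (λ i j → mul-congʳ-length (f [ i ]) m (λ a |a|≡|m| → g≡g′ (j ∷ a) (cong suc |a|≡|m|))) e

-- The bound of such a family at a list is the length of that list, so the single truncation at
-- `length m` serves all factors of `m`, and finite distributivity applies.
*-distribˡ-∑ : ∀ x (F : ℕ → Series) → x * ∑ (λ i → t[1+ i ] * F i) ≈ ∑ (λ i → t[1+ i ] * (x * F i))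
*-distribˡ-∑ x F = coeffwise λ m → trans
  (mul-congʳ-length (coeff x) m (λ a |a|≡|m| →
    coeff-∑ (λ i → t[1+ i ] * F i) a (ℕ.≤-reflexive |a|≡|m|)))
  (trans (at (SeriesRing.trans
    (SeriesSum.*-distribˡ-sum {length m} x (λ i → t[1+ toℕ i ] * F (toℕ i)))
    (SeriesSum.sum-cong-≋ {length m} (λ i → x∙yz≈y∙xz x t[1+ toℕ i ] (F (toℕ i))))) m)
  (sym (coeff-∑ (λ i → t[1+ i ] * (x * F i)) m ℕ.≤-refl)))

∑t-+ : ∀ (F G : ℕ → Series) → ∑ (λ i → t[1+ i ] * (F i + G i)) ≈
               ∑ (λ i → t[1+ i ] * F i) + ∑ (λ i → t[1+ i ] * G i)
∑t-+ F G = SeriesRing.trans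
  (∑-cong (λ i → SeriesRing.distribˡ t[1+ i ] (F i) (G i)))
  (∑-+ (λ i → t[1+ i ] * F i) (λ i → t[1+ i ] * G i))
  where
  -- These summands do not have the form `t[1+ i ] * _`, so their local finiteness is supplied here.
  instance
    sum-locallyFinite : LocallyFinite (λ i → t[1+ i ] * F i + t[1+ i ] * G i)
    sum-locallyFinite = record
      { bound    = length
      ; vanishes = λ m i m≤i →
          cong₂ ℤ._+_ (vanishes {λ i → t[1+ i ] * F i} m i m≤i) (vanishes {λ i → t[1+ i ] * G i} m i m≤i)
      }

∑t1≈S₁ : ∑ (λ i → t[1+ i ] * 1#) ≈ S₁
∑t1≈S₁ = ∑-cong (λ i → SeriesRing.*-identityʳ t[1+ i ])

-- The geometric sum and rearrangements in the ring of series.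

-- With T the sum for `n`, the inductive step is (S - 1)(1 + S T) + 1 = S ((S - 1) T + 1). Keeping
-- the 1 on the left lets `∑t-+` split the identity once it is multiplied by the variables and
-- summed.
geometric-sum : ∀ S n → (S - 1#) * ∑< n (S ^_) + 1# ≈ S ^ n
geometric-sum S zero    = SeriesRing.trans
  (+-congʳ (SeriesRing.zeroʳ (S - 1#))) (SeriesRing.+-identityˡ 1#)
geometric-sum S (suc n) = begin
  (S - 1#) * (1# + ∑< n (λ j → S * S ^ j)) + 1#
    ≈⟨ +-congʳ (*-congˡ (+-congˡ (SeriesSum.*-distribˡ-sum {n} S (λ j → S ^ toℕ j)))) ⟨
  (S - 1#) * (1# + S * ∑< n (S ^_)) + 1#
    ≈⟨ +-congʳ (SeriesRing.distribˡ (S - 1#) 1# _) ⟩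
  (S - 1#) * 1# + (S - 1#) * (S * ∑< n (S ^_)) + 1#
    ≈⟨ +-congʳ (+-cong (SeriesRing.*-identityʳ (S - 1#)) (x∙yz≈y∙xz (S - 1#) S _)) ⟩
  (S - 1#) + S * ((S - 1#) * ∑< n (S ^_)) + 1#
    ≈⟨ +-congʳ (SeriesRing.+-comm (S - 1#) _) ⟩
  S * ((S - 1#) * ∑< n (S ^_)) + (S - 1#) + 1#
    ≈⟨ SeriesRing.+-assoc _ (S - 1#) 1# ⟩
  S * ((S - 1#) * ∑< n (S ^_)) + (S - 1# + 1#)
    ≈⟨ +-congˡ (SeriesRing.trans (//-rightDividesˡ 1# S) (SeriesRing.sym (SeriesRing.*-identityʳ S))) ⟩
  S * ((S - 1#) * ∑< n (S ^_)) + S * 1#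
    ≈⟨ SeriesRing.distribˡ S _ 1# ⟨
  S * ((S - 1#) * ∑< n (S ^_) + 1#)
    ≈⟨ *-congˡ (geometric-sum S n) ⟩
  S * S ^ n ∎
  where open ≈-Reasoning

x≈y+z⇒x-y≈z : ∀ {x y z} → x ≈ y + z → x - y ≈ z
x≈y+z⇒x-y≈z {x} {y} {z} x≈y+z = SeriesRing.trans (+-congʳ x≈y+z) (xyx⁻¹≈y y z)

-- The equation for S yields recursions of this shape for both S and S - 1.
x≈xy+z⇒x[1-y]≈z : ∀ {x y z} → x ≈ x * y + z → x * (1# - y) ≈ z
x≈xy+z⇒x[1-y]≈z {x} {y} {z} eq = begin
  x * (1# - y)      ≈⟨ x[y-z]≈xy-xz x 1# y ⟩
  x * 1# - x * y    ≈⟨ +-congʳ (SeriesRing.*-identityʳ x) ⟩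
  x - x * y         ≈⟨ x≈y+z⇒x-y≈z eq ⟩
  z                 ∎
  where open ≈-Reasoning

-- Passage to the fraction field.

ι-cong : ∀ {a b} → a ≈ b → ι a ≃ ι b
ι-cong a≈b = *≃* (*-congʳ a≈b)

ι-* : ∀ a b → ι (a * b) ≃ ι a *ᶠ ι b
ι-* a b = *≃* (*-congˡ (SeriesRing.*-identityʳ 1#))

ι-- : ∀ a b → ι (a - b) ≃ ι a -ᶠ ι b
ι-- a b = *≃* (SeriesRing.*-cong
  (SeriesRing.sym (+-cong (SeriesRing.*-identityʳ a) (SeriesRing.*-identityʳ (- b))))
  (SeriesRing.*-identityʳ 1#))

-- A product equal to 1 also forces `y` to be nonzero, since otherwise 1 would be 0. So for each of
-- the four formulas it is enough to compute a product.
*≃1⇒≃⁻¹ : ∀ {x y} → x *ᶠ y ≃ 1ᶠ → x ≃ y ⁻¹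
*≃1⇒≃⁻¹ {x} {y} xy≃1 = y≄0 , (begin
  x                      ≈⟨ ℱ.*-identityʳ x ⟨
  x *ᶠ 1ᶠ                ≈⟨ ℱ.*-congˡ {x} (inv-inverseʳ y y≄0) ⟨
  x *ᶠ (y *ᶠ inv y y≄0)  ≈⟨ ℱ.*-assoc x y (inv y y≄0) ⟨
  x *ᶠ y *ᶠ inv y y≄0    ≈⟨ ℱ.*-congʳ {inv y y≄0} xy≃1 ⟩
  1ᶠ *ᶠ inv y y≄0        ≈⟨ ℱ.*-identityˡ (inv y y≄0) ⟩
  inv y y≄0              ∎)
  where
  open import Relation.Binary.Reasoning.Setoid ℱ.setoid
  y≄0 : y ≄ 0ᶠ
  y≄0 y≃0 = ι-≄0 1≉0 (begin
    1ᶠ        ≈⟨ xy≃1 ⟨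
    x *ᶠ y    ≈⟨ ℱ.*-congˡ {x} y≃0 ⟩
    x *ᶠ 0ᶠ   ≈⟨ ℱ.zeroʳ x ⟩
    0ᶠ        ∎)

-- Clears one denominator; two applications clear both denominators of H.
div-*-≃ : ∀ x y z w (y≄0 : y ≄ 0ᶠ) → x *ᶠ z ≃ w *ᶠ y → div x y y≄0 *ᶠ z ≃ w
div-*-≃ x y z w y≄0 xz≃wy = begin
  x *ᶠ y⁻¹ *ᶠ z     ≈⟨ xy∙z≈xz∙y x y⁻¹ z ⟩
  x *ᶠ z *ᶠ y⁻¹     ≈⟨ ℱ.*-congʳ {y⁻¹} xz≃wy ⟩
  w *ᶠ y *ᶠ y⁻¹     ≈⟨ ℱ.*-assoc w y y⁻¹ ⟩
  w *ᶠ (y *ᶠ y⁻¹)   ≈⟨ ℱ.*-congˡ {w} (inv-inverseʳ y y≄0) ⟩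
  w *ᶠ 1ᶠ           ≈⟨ ℱ.*-identityʳ w ⟩
  w                 ∎
  where
  open import Relation.Binary.Reasoning.Setoid ℱ.setoid
  open import Algebra.Properties.CommutativeSemigroup ℱ.*-commutativeSemigroup using (xy∙z≈xz∙y)
  y⁻¹ = inv y y≄0

-- Power series identities satisfied by a solution S.

module Solution (S : Series) (S-eq : S ≈ 1# + ∑ (λ i → t[1+ i ] * S ^ suc i)) where
  open ≈-Reasoning

  -- The index `i` is n - 1 in `P` and `Q` but n - 2 in `R`, whose sum starts at n = 2.
  P Q R : Series
  P = ∑ (λ i → t[1+ i ] * S ^ i)
  Q = ∑ (λ i → t[1+ i ] * ∑< (suc i) (S ^_))
  R = ∑ (λ i → t[1+ suc i ] * ∑< (suc i) (λ j → S ^ suc j))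

  S-1≈∑ : S - 1# ≈ ∑ (λ i → t[1+ i ] * S ^ suc i)
  S-1≈∑ = x≈y+z⇒x-y≈z S-eq

  S-1≈SP : S - 1# ≈ S * P
  -- `S ^ suc i` is `S * S ^ i` by definition, so a factor S comes out of the sum.
  S-1≈SP = SeriesRing.trans S-1≈∑ (SeriesRing.sym (*-distribˡ-∑ S (S ^_)))

  S[1-P]≈1 : S * (1# - P) ≈ 1#
  S[1-P]≈1 = x≈xy+z⇒x[1-y]≈z (begin
    S            ≈⟨ //-rightDividesˡ 1# S ⟨
    S - 1# + 1#  ≈⟨ +-congʳ S-1≈SP ⟩
    S * P + 1#   ∎)

  [S-1][1-Q]≈S₁ : (S - 1#) * (1# - Q) ≈ S₁
  [S-1][1-Q]≈S₁ = x≈xy+z⇒x[1-y]≈z (begin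
    S - 1#
      ≈⟨ S-1≈∑ ⟩
    ∑ (λ i → t[1+ i ] * S ^ suc i)
      -- Each power is expanded backwards: the multiples of S - 1 will add up to (S - 1) Q and the
      -- constants 1 to S₁.
      ≈⟨ ∑-cong (λ i → *-congˡ {t[1+ i ]} (geometric-sum S (suc i))) ⟨
    ∑ (λ i → t[1+ i ] * ((S - 1#) * ∑< (suc i) (S ^_) + 1#))
      ≈⟨ ∑t-+ (λ i → (S - 1#) * ∑< (suc i) (S ^_)) (λ _ → 1#) ⟩
    ∑ (λ i → t[1+ i ] * ((S - 1#) * ∑< (suc i) (S ^_))) + ∑ (λ i → t[1+ i ] * 1#)
      ≈⟨ +-cong (SeriesRing.sym (*-distribˡ-∑ (S - 1#) (λ i → ∑< (suc i) (S ^_)))) ∑t1≈S₁ ⟩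
    (S - 1#) * Q + S₁ ∎)

  Q≈S₁+R : Q ≈ S₁ + R
  Q≈S₁+R = begin
    Q
      -- The head of `∑< (suc i) (S ^_)` is 1 by definition; these heads contribute S₁.
      ≈⟨ ∑t-+ (λ _ → 1#) (λ i → ∑< i (λ j → S ^ suc j)) ⟩
    ∑ (λ i → t[1+ i ] * 1#) + ∑ (λ i → t[1+ i ] * ∑< i (λ j → S ^ suc j))
      -- The term of t₁ has an empty inner sum; dropping it shifts the index to that of `R`.
      ≈⟨ +-cong ∑t1≈S₁ (∑-head (λ i → t[1+ i ] * ∑< i (λ j → S ^ suc j))) ⟩
    S₁ + (t[1+ 0 ] * 0# + R)
      ≈⟨ +-congˡ (+-congʳ (SeriesRing.zeroʳ t[1+ 0 ])) ⟩
    S₁ + (0# + R)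
      ≈⟨ +-congˡ (SeriesRing.+-identityˡ R) ⟩
    S₁ + R ∎

  [S-1][1-R]≈SS₁ : (S - 1#) * (1# - R) ≈ S * S₁
  [S-1][1-R]≈SS₁ = begin
    (S - 1#) * (1# - R)
      ≈⟨ *-congˡ 1-R≈[1-Q]+S₁ ⟩
    (S - 1#) * ((1# - Q) + S₁)
      ≈⟨ SeriesRing.distribˡ (S - 1#) (1# - Q) S₁ ⟩
    (S - 1#) * (1# - Q) + (S - 1#) * S₁
      ≈⟨ +-congʳ [S-1][1-Q]≈S₁ ⟩
    S₁ + (S - 1#) * S₁
      ≈⟨ SeriesRing.+-comm S₁ _ ⟩
    (S - 1#) * S₁ + S₁
      ≈⟨ +-congˡ (SeriesRing.*-identityˡ S₁) ⟨
    (S - 1#) * S₁ + 1# * S₁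
      ≈⟨ SeriesRing.distribʳ S₁ (S - 1#) 1# ⟨
    (S - 1# + 1#) * S₁
      ≈⟨ *-congʳ (//-rightDividesˡ 1# S) ⟩
    S * S₁ ∎
    where
    1-R≈[1-Q]+S₁ : 1# - R ≈ (1# - Q) + S₁
    1-R≈[1-Q]+S₁ = begin
      1# - R             ≈⟨ +-congˡ (SeriesRing.-‿cong (x≈y+z⇒x-y≈z Q≈S₁+R)) ⟨
      1# - (Q - S₁)      ≈⟨ +-congˡ (⁻¹-anti-homo-// Q S₁) ⟩
      1# + (S₁ - Q)      ≈⟨ +-congˡ (SeriesRing.+-comm S₁ (- Q)) ⟩
      1# + (- Q + S₁)    ≈⟨ SeriesRing.+-assoc 1# (- Q) S₁ ⟨
      (1# - Q) + S₁      ∎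

theorem2p1 :
    (S : Series) (S-eq : S ≈ 1# + ∑ (λ i → t[1+ i ] * S ^ suc i)) →
    let G = div (ι (S - 1#)) (ι S₁) (ι-≄0 S₁≉0)
        H = div G (ι S) (ι-≄0 (S≉0 S-eq))
    in  (ι S ≃ ι (1# - ∑ (λ i → t[1+ i ] * S ^ i)) ⁻¹)
      × (ι S ≃ (1ᶠ -ᶠ H *ᶠ ι S₁) ⁻¹)
      × (G ≃ ι (1# - ∑ (λ i → t[1+ i ] * ∑< (suc i) (λ j → S ^ j))) ⁻¹)
      × (H ≃ ι (1# - ∑ (λ i → t[1+ suc i ] * ∑< (suc i) (λ j → S ^ suc j))) ⁻¹)
theorem2p1 S S-eq =
    *≃1⇒≃⁻¹ ιS*ι[1-P]≃1
  , *≃1⇒≃⁻¹ (begin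
      ι S *ᶠ (1ᶠ -ᶠ H *ᶠ ι S₁)  ≈⟨ ℱ.*-congˡ {ι S} (ℱ.+-congˡ {1ᶠ} (ℱ.-‿cong HS₁≃P)) ⟩
      ι S *ᶠ (1ᶠ -ᶠ ι P)        ≈⟨ ℱ.*-congˡ {ι S} (ι-- 1# P) ⟨
      ι S *ᶠ ι (1# - P)         ≈⟨ ιS*ι[1-P]≃1 ⟩
      1ᶠ                        ∎)
  , *≃1⇒≃⁻¹ (div-*-≃ (ι (S - 1#)) (ι S₁) (ι (1# - Q)) 1ᶠ (ι-≄0 S₁≉0) (begin
      ι (S - 1#) *ᶠ ι (1# - Q)  ≈⟨ ι-* (S - 1#) (1# - Q) ⟨
      ι ((S - 1#) * (1# - Q))   ≈⟨ ι-cong [S-1][1-Q]≈S₁ ⟩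
      ι S₁                      ≈⟨ ℱ.*-identityˡ (ι S₁) ⟨
      1ᶠ *ᶠ ι S₁                ∎))
  , *≃1⇒≃⁻¹ (div-*-≃ G (ι S) (ι (1# - R)) 1ᶠ (ι-≄0 (S≉0 S-eq)) (begin
      -- The outer application removes the denominator S of H, this inner one the denominator S₁ of
      -- G.
      G *ᶠ ι (1# - R)           ≈⟨ div-*-≃ (ι (S - 1#)) (ι S₁) (ι (1# - R)) (ι S) (ι-≄0 S₁≉0) (begin
        ι (S - 1#) *ᶠ ι (1# - R)  ≈⟨ ι-* (S - 1#) (1# - R) ⟨
        ι ((S - 1#) * (1# - R))   ≈⟨ ι-cong [S-1][1-R]≈SS₁ ⟩
        ι (S * S₁)                ≈⟨ ι-* S S₁ ⟩
        ι S *ᶠ ι S₁               ∎) ⟩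
      ι S                       ≈⟨ ℱ.*-identityˡ (ι S) ⟨
      1ᶠ *ᶠ ι S                 ∎))
  where
  open Solution S S-eq
  open import Relation.Binary.Reasoning.Setoid ℱ.setoid
  G H : Fraction
  G = div (ι (S - 1#)) (ι S₁) (ι-≄0 S₁≉0)
  H = div G (ι S) (ι-≄0 (S≉0 S-eq))

  ιS*ι[1-P]≃1 : ι S *ᶠ ι (1# - P) ≃ 1ᶠ
  ιS*ι[1-P]≃1 = begin
    ι S *ᶠ ι (1# - P)  ≈⟨ ι-* S (1# - P) ⟨
    ι (S * (1# - P))   ≈⟨ ι-cong S[1-P]≈1 ⟩
    1ᶠ                 ∎

  HS₁≃P : H *ᶠ ι S₁ ≃ ι P
  HS₁≃P = div-*-≃ G (ι S) (ι S₁) (ι P) (ι-≄0 (S≉0 S-eq)) (begin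
    G *ᶠ ι S₁    ≈⟨ div-*-≃ (ι (S - 1#)) (ι S₁) (ι S₁) (ι (S - 1#)) (ι-≄0 S₁≉0) ℱ.refl ⟩
    ι (S - 1#)   ≈⟨ ι-cong S-1≈SP ⟩
    ι (S * P)    ≈⟨ ι-* S P ⟩
    ι S *ᶠ ι P   ≈⟨ ℱ.*-comm (ι S) (ι P) ⟩
    ι P *ᶠ ι S   ∎)
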